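{- Let $\sigma=(a_1,\ldots,a_s)$ be a partition of the positive integer $r$ with $a_1\ge a_2\ge\cdots\ge a_s\ge 1$, let $n\ge s$ and $q\ge a_1$, and let $H=H(n,r,q\mid\sigma)$. Let $1\le k\le r-1$. Then \[\alpha_k(H)=\max\Big\{\, q\,(t(B)-1)+\sum_{i=t(B)}^{s} b_i+(n-s)\,b_s \;:\; B=(b_1,\ldots,b_n)\in M(q,k,\sigma)\Big\}.\]
   Context: A $\sigma$-hypergraph $H=H(n,r,q\mid\sigma)$, for a partition $\sigma=(a_1,\ldots,a_s)$ of $r$ with $s=s(\sigma)$ parts, is the $r$-uniform hypergraph whose vertex set is the disjoint union of $n$ classes $V_1,\ldots,V_n$, each of size $q$; an $r$-subset $K$ of vertices is an edge iff the multiset of non-zero values $|K\cap V_i|$ ($1\le i\le n$) equals $\sigma$. For $1\le k\le r-1$, a set $S$ of vertices of an $r$-uniform hypergraph is $k$-independent if $|E\cap S|\le k$ for every edge $E$; $\alpha_k(H)$ is the largest cardinality of a $k$-independent set. A sequence $B=(b_1,\ldots,b_n)$ of non-negative integers is $(q,k,\sigma)$-feasible if $b_1\ge b_2\ge\cdots\ge b_n$, $b_j=b_s$ for all $j\ge s$, $q\ge\max\{a_1,b_1\}$, and $\sum_{i=1}^{s}\min\{a_i,b_i\}=k$. A feasible sequence $B^*$ dominates a feasible sequence $B$ if $b^*_i\ge b_i$ for all $i$ and $\sum_i b^*_i>\sum_i b_i$; a feasible sequence is maximal if no feasible sequence dominates it. $M(q,k,\sigma)$ is the set of all maximal $(q,k,\sigma)$-feasible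 sequences. For a feasible sequence $B$, $t(B)$ denotes the smallest index $t\in\{1,\ldots,s\}$ with $b_t<a_t$ (such an index exists since $k<r$). -}

module Defs where

open import Data.Bool.Base using (if_then_else_)
open import Data.Fin.Base as Fin using (Fin; zero; toℕ; fromℕ; inject≤; quotient)
open import Data.Fin.Properties as Fin using (¬∀⟶∃¬-smallest)
open import Data.Fin.Subset using (Subset; _∩_; ∣_∣; ⊥)
open import Data.Fin.Subset.Properties using (anySubset?; ∣p∣≤n; ∣⊥∣≡0; ∩-zeroʳ)
open import Data.List.Base using (List; []; _∷_; _++_; filter; tabulate)
open import Data.List.Membership.Propositional.Properties using (∈-∃++)
open import Data.List.Relation.Binary.Permutation.Propositional using (_↭_; ↭-refl; ↭-sym; ↭-trans; ↭-prep)
open import Data.List.Relation.Binary.Permutation.Propositional.Properties using (shift; drop-∷; ∈-resp-↭; ↭-empty-inv)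
open import Data.List.Relation.Unary.Any using (here)
open import Data.Nat.Base using (ℕ; zero; suc; _+_; _*_; _∸_; _≤_; _<_; _⊓_; _⊔_; z≤n)
open import Data.Nat.Properties as ℕ using (+-0-commutativeMonoid)
import Data.Vec.Base as Vec
open import Data.Product.Base using (∃; _×_; _,_; proj₁; proj₂)
open import Relation.Binary.PropositionalEquality
open import Relation.Nullary using (¬_; Dec; yes; no; does; ¬?; _×-dec_; contradiction)
open import Relation.Nullary.Decidable using (map′; decidable-stable)
open import Relation.Unary using (Pred; Decidable)
open import Level using (0ℓ)

open import Algebra.Properties.CommutativeMonoid.Sum +-0-commutativeMonoid public
  using (sum-cong-≋; sum-syntax)
open import Data.List.Membership.DecPropositional ℕ._≟_ using (_∈?_)

-- IsMaximum P m says that m = max { x : P x }; in particular P is inhabited.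
IsMaximum : Pred ℕ 0ℓ → ℕ → Set
IsMaximum P m = P m × (∀ x → P x → x ≤ m)

-- The largest m ≤ N with P m (and 0 if there is none).
greatest : {P : Pred ℕ 0ℓ} → Decidable P → ℕ → ℕ
greatest P? zero    = 0
greatest P? (suc N) = if does (P? (suc N)) then suc N else greatest P? N

greatest-isMaximum : {P : Pred ℕ 0ℓ} (P? : Decidable P) (N : ℕ) →
                     P 0 → (∀ x → P x → x ≤ N) → IsMaximum P (greatest P? N)
greatest-isMaximum P? zero    p0 bd = p0 , bd
greatest-isMaximum P? (suc N) p0 bd with P? (suc N)
... | yes p = p , bd
... | no ¬p = greatest-isMaximum P? N p0
  λ x px → ℕ.≤-pred (ℕ.≤∧≢⇒< (bd x px) λ { refl → ¬p px })

_↭?_ : (xs ys : List ℕ) → Dec (xs ↭ ys)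
[]       ↭? []       = yes ↭-refl
[]       ↭? (y ∷ ys) = no λ p → contradiction (↭-empty-inv (↭-sym p)) λ ()
(x ∷ xs) ↭? ys with x ∈? ys
... | no x∉ys = no λ p → x∉ys (∈-resp-↭ p (here refl))
... | yes x∈ys with ∈-∃++ x∈ys
...   | us , vs , refl = map′
  (λ p → ↭-trans (↭-prep x p) (↭-sym (shift x us vs)))
  (λ p → drop-∷ (↭-trans p (shift x us vs)))
  (xs ↭? (us ++ vs))

record Hypergraph (r : ℕ) : Set₁ where
  field
    order   : ℕ
    Edge    : Pred (Subset order) 0ℓ
    edge?   : Decidable Edge
    uniform : ∀ {K} → Edge K → ∣ K ∣ ≡ r

module _ {r : ℕ} (H : Hypergraph r) (k : ℕ) where
  open Hypergraph H

  Independent : Pred (Subset order) 0ℓ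
  Independent S = ∀ E → Edge E → ∣ E ∩ S ∣ ≤ k

  independent? : Decidable Independent
  independent? S = map′
    (λ ¬bad E e → decidable-stable (_ ℕ.≤? k) λ ≰k → ¬bad (E , e , ≰k))
    (λ ind (E , e , ≰k) → ≰k (ind E e))
    (¬? (anySubset? λ E → edge? E ×-dec ¬? (∣ E ∩ S ∣ ℕ.≤? k)))

  IndependentSize : Pred ℕ 0ℓ
  IndependentSize m = ∃ λ S → Independent S × ∣ S ∣ ≡ m

  independentSize? : Decidable IndependentSize
  independentSize? m = anySubset? λ S → independent? S ×-dec (∣ S ∣ ℕ.≟ m)

  α : ℕ
  α = greatest independentSize? order

  α-isMaximum : IsMaximum IndependentSize α
  α-isMaximum = greatest-isMaximum independentSize? order
    (⊥ , (λ E _ → subst (_≤ k) (sym (∣E∩⊥∣≡0 E)) z≤n) , ∣⊥∣≡0 order)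
    (λ { _ (S , _ , refl) → ∣p∣≤n S })
    where
    ∣E∩⊥∣≡0 : ∀ E → ∣ E ∩ ⊥ ∣ ≡ 0
    ∣E∩⊥∣≡0 E = trans (cong ∣_∣ (∩-zeroʳ E)) (∣⊥∣≡0 order)

-- Partitions of a positive integer r; they have at least one part, so the
-- number of parts is stored as a successor.  Indices are shifted by one:
-- a zero is a₁ and a (fromℕ s-1) is aₛ.
record Partition (r : ℕ) : Set where
  field
    s-1 : ℕ

  s : ℕ
  s = suc s-1

  field
    a          : Fin s → ℕ
    decreasing : ∀ {i j} → i Fin.≤ j → a j ≤ a i
    positive   : ∀ i → 1 ≤ a i
    total      : ∑[ i < s ] a i ≡ r

-- The vertices are Fin (n * q), which Data.Fin.Base.remQuot identifies with
-- Fin n × Fin q; vertexClass i is the block of the q vertices with first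
-- coordinate i.
vertexClass : (n q : ℕ) → Fin n → Subset (n * q)
vertexClass n q i = Vec.tabulate λ v → does (quotient q v Fin.≟ i)

nonzeroIntersections : (n q : ℕ) → Subset (n * q) → List ℕ
nonzeroIntersections n q K =
  filter (λ x → ¬? (x ℕ.≟ 0)) (tabulate λ i → ∣ K ∩ vertexClass n q i ∣)

-- Equality of multisets is rendered as _↭_ on lists.
σ-hypergraph : (n r q : ℕ) → Partition r → Hypergraph r
σ-hypergraph n r q σ = record
  { order   = n * q
  ; Edge    = λ K → ∣ K ∣ ≡ r × nonzeroIntersections n q K ↭ tabulate a
  ; edge?   = λ K → (∣ K ∣ ℕ.≟ r) ×-dec (nonzeroIntersections n q K ↭? tabulate a)
  ; uniform = proj₁
  }
  where open Partition σ

module _ {n r : ℕ} (q k : ℕ) (σ : Partition r) (s≤n : Partition.s σ ≤ n) where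
  open Partition σ using (s-1; s; a)

  -- The position in b₁,…,bₙ of an index from 1,…,s.
  ι : Fin s → Fin n
  ι i = inject≤ i s≤n

  record Feasible (b : Fin n → ℕ) : Set where
    field
      decreasing : ∀ {i j} → i Fin.≤ j → b j ≤ b i
      constant   : ∀ j → s ≤ suc (toℕ j) → b j ≡ b (ι (fromℕ s-1))
      bounded    : a zero ⊔ b (ι zero) ≤ q
      weight     : ∑[ i < s ] (a i ⊓ b (ι i)) ≡ k

  Dominates : (b* b : Fin n → ℕ) → Set
  Dominates b* b = (∀ i → b i ≤ b* i) × ∑[ i < n ] b i < ∑[ i < n ] b* i

  record M (b : Fin n → ℕ) : Set where
    field
      feasible : Feasible b
      maximal  : ¬ ∃ λ b* → Feasible b* × Dominates b* b

  IsFirstDeficit : (Fin n → ℕ) → Fin s → Set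
  IsFirstDeficit b t = b (ι t) < a t × (∀ i → b (ι i) < a i → t Fin.≤ i)

  firstDeficit : k < r → ∀ {b} → Feasible b → ∃ (IsFirstDeficit b)
  firstDeficit k<r {b} f =
    let t , a≰b , below = ¬∀⟶∃¬-smallest s (λ i → a i ≤ b (ι i)) (λ i → a i ℕ.≤? b (ι i)) notAll
    in t , ℕ.≰⇒> a≰b , λ i b<a → ℕ.≮⇒≥ λ i<t → ℕ.<⇒≱ b<a
         (subst (λ j → a j ≤ b (ι j)) (lower i<t) (below (Fin.fromℕ< i<t)))
    where
    notAll : ¬ (∀ i → a i ≤ b (ι i))
    notAll all = ℕ.<⇒≢ k<r (begin
      k                           ≡⟨ Feasible.weight f ⟨
      ∑[ i < s ] (a i ⊓ b (ι i))  ≡⟨ sum-cong-≋ (λ i → ℕ.m≤n⇒m⊓n≡m (all i)) ⟩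
      ∑[ i < s ] a i              ≡⟨ Partition.total σ ⟩
      r                           ∎)
      where open ≡-Reasoning
    lower : ∀ {t i : Fin s} (i<t : i Fin.< t) → Fin.inject {i = t} (Fin.fromℕ< i<t) ≡ i
    lower {t} i<t = Fin.toℕ-injective
      (trans (Fin.toℕ-inject {i = t} (Fin.fromℕ< i<t)) (Fin.toℕ-fromℕ< i<t))

  t : k < r → ∀ {b} → Feasible b → Fin s
  t k<r f = proj₁ (firstDeficit k<r f)

  -- As indices start at 0, toℕ (t k<r f) is t(B) - 1.
  value : k < r → ∀ {b} → Feasible b → ℕ
  value k<r {b} f =
    q * toℕ (t k<r f)
    + ∑[ i < s ] (if does (t k<r f Fin.≤? i) then b (ι i) else 0)
    + (n ∸ s) * b (ι (fromℕ s-1))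

{-# OPTIONS --safe #-}

-- A set meeting the classes in sizes c₁ ≥ … ≥ cₙ is k-independent iff
-- Σ_{i≤s} min(aᵢ, cᵢ) ≤ k: by the rearrangement inequality for minima no edge meets
-- it in more points, and an edge placing the part aᵢ in the i-th largest class attains
-- the bound.  Filling the classes before the first deficit up to q does not change this
-- sum, so the value of every feasible sequence is the size of a k-independent set.
-- Conversely, the sorted class sizes of a largest k-independent set lie below a feasible
-- sequence B; a sequence dominating B would give a larger independent set, so B is maximal.
module Submission where

open import Defs
open import Data.Bool.Base using (if_then_else_)
open import Data.Fin.Base as Fin using (Fin; zero; suc; toℕ; fromℕ; fromℕ<; inject≤; quotient; _↑ˡ_; _↑ʳ_)
import Data.Fin.Properties as Fin
open import Data.Fin.Subset using (Subset; _∩_; ∣_∣; ⊥; ⊤; inside; outside)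
open import Data.Fin.Subset.Properties using (∣p∣≤n; ∣⊥∣≡0; ∩-zeroʳ; ∩-identityʳ; ∣p∩q∣≤∣p∣⊓∣q∣)
open import Data.List.Base using (List; []; _∷_; _++_; filter; length; lookup; replicate; tabulate; zipWith)
import Data.List.Properties as List
open import Data.List.Membership.Propositional.Properties using (∈-∃++)
open import Data.List.Relation.Binary.Permutation.Propositional using (_↭_; ↭-sym; ↭-trans; refl; prep; swap; trans)
open import Data.List.Relation.Binary.Permutation.Propositional.Properties using (All-resp-↭; ∈-resp-↭; drop-mid; filter-↭; ↭-length)
open import Data.List.Relation.Unary.All as All using (All; []; _∷_)
import Data.List.Relation.Unary.All.Properties as All
open import Data.List.Relation.Unary.AllPairs using (AllPairs; []; _∷_)
import Data.List.Relation.Unary.AllPairs.Properties as AllPairs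
open import Data.List.Relation.Unary.Any using (here)
open import Data.List.Relation.Unary.Sorted.TotalOrder.Properties using (lookup-mono-≤)
import Data.List.Sort
open import Data.Nat.Base using (ℕ; zero; suc; _+_; _*_; _∸_; _≤_; _<_; _≥_; _⊓_; _⊔_; z≤n; s≤s; s≤s⁻¹)
open import Data.Nat.ListAction using (sum)
open import Data.Nat.ListAction.Properties using (sum-++; sum-↭)
open import Data.Nat.Properties as ℕ using (≤-refl; ≤-trans; module ≤-Reasoning)
open import Data.Product.Base using (∃; Σ; _×_; _,_; proj₁; proj₂)
open import Data.Sum.Base using (inj₁; inj₂)
open import Data.Vec.Base as Vec using (Vec; []; _∷_; concat)
import Data.Vec.Functional as Functional
import Data.Vec.Properties as Vec
open import Function.Base using (_∘_)
open import Function.Bundles using (mk⇔)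
import Relation.Binary.Construct.Flip.EqAndOrd as Flip
open import Relation.Binary.Bundles using (DecTotalOrder)
open import Relation.Binary.PropositionalEquality as ≡ using (_≡_; _≢_; refl; cong; cong₂; subst; sym; module ≡-Reasoning)
open import Relation.Nullary using (¬_; ¬?; Dec; yes; no; does; contradiction)
open import Relation.Nullary.Decidable using (does-⇔)

Antitone : ∀ {n} → (Fin n → ℕ) → Set
Antitone f = ∀ {i j} → i Fin.≤ j → f j ≤ f i

-- Finite sums

∑-mono-≤ : ∀ {n} {f g : Fin n → ℕ} → (∀ i → f i ≤ g i) → ∑[ i < n ] f i ≤ ∑[ i < n ] g i
∑-mono-≤ {zero}  f≤g = z≤n
∑-mono-≤ {suc n} f≤g = ℕ.+-mono-≤ (f≤g zero) (∑-mono-≤ (f≤g ∘ suc))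

sum-tabulate : ∀ {n} (f : Fin n → ℕ) → sum (tabulate f) ≡ ∑[ i < n ] f i
sum-tabulate {zero}  f = refl
sum-tabulate {suc n} f = cong (f zero +_) (sum-tabulate (f ∘ suc))

-- Indices start at 0, so the constant tail begins at index `s` and has `n ∸ s` entries; it yields
-- the last term of `value`.
∑-inject≤ : ∀ {s n} (s≤n : s ≤ n) (f : Fin n → ℕ) v → (∀ j → s ≤ toℕ j → f j ≡ v) →
            ∑[ i < n ] f i ≡ ∑[ i < s ] f (inject≤ i s≤n) + (n ∸ s) * v
∑-inject≤ {n = zero}  z≤n f v f≡v = refl
∑-inject≤ {n = suc n} z≤n f v f≡v = cong₂ _+_ (f≡v zero z≤n) (∑-inject≤ z≤n (f ∘ suc) v λ j _ → f≡v (suc j) z≤n)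
∑-inject≤ {suc s} {suc n} (s≤s s≤n) f v f≡v = begin
  f zero + ∑[ i < n ] f (suc i)
    ≡⟨ cong (f zero +_) (∑-inject≤ s≤n (f ∘ suc) v λ j s≤j → f≡v (suc j) (s≤s s≤j)) ⟩
  f zero + (∑[ i < s ] f (suc (inject≤ i s≤n)) + (n ∸ s) * v)
    ≡⟨ ℕ.+-assoc (f zero) _ _ ⟨
  f zero + ∑[ i < s ] f (suc (inject≤ i s≤n)) + (n ∸ s) * v ∎
  where open ≡-Reasoning

-- Exactly `toℕ t` indices lie before `t`, and each of them contributes `q`; this is the first term
-- of `value`.
∑-fill : ∀ {s} q (t : Fin s) (f : Fin s → ℕ) →
         ∑[ i < s ] (if does (t Fin.≤? i) then f i else q) ≡
         q * toℕ t + ∑[ i < s ] (if does (t Fin.≤? i) then f i else 0)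
∑-fill {s} q zero f = cong (_+ ∑[ i < s ] f i) (sym (ℕ.*-zeroʳ q))
∑-fill {suc s} q (suc t) f = begin
  q + ∑[ i < s ] (if does (suc t Fin.≤? suc i) then f (suc i) else q)
    ≡⟨ cong (q +_) (sum-cong-≋ λ i → cong (if_then f (suc i) else q) (suc-≤? i)) ⟩
  q + ∑[ i < s ] (if does (t Fin.≤? i) then f (suc i) else q)
    ≡⟨ cong (q +_) (∑-fill q t (f ∘ suc)) ⟩
  q + (q * toℕ t + ∑[ i < s ] (if does (t Fin.≤? i) then f (suc i) else 0))
    ≡⟨ ℕ.+-assoc q _ _ ⟨
  q + q * toℕ t + ∑[ i < s ] (if does (t Fin.≤? i) then f (suc i) else 0)
    ≡⟨ cong₂ _+_ (ℕ.*-suc q (toℕ t)) (sum-cong-≋ λ i → cong (if_then f (suc i) else 0) (suc-≤? i)) ⟨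
  q * suc (toℕ t) + ∑[ i < s ] (if does (suc t Fin.≤? suc i) then f (suc i) else 0) ∎
  where
  open ≡-Reasoning
  suc-≤? : ∀ i → does (suc t Fin.≤? suc i) ≡ does (t Fin.≤? i)
  suc-≤? i = does-⇔ (mk⇔ s≤s⁻¹ s≤s) (suc t Fin.≤? suc i) (t Fin.≤? i)

-- Rearrangement for sums of minima

-- Truncation by `zipWith` is harmless: a surplus entry acts as if it were paired with 0.
minSum : List ℕ → List ℕ → ℕ
minSum xs ys = sum (zipWith _⊓_ xs ys)

minSum-tabulate : ∀ {s n} (s≤n : s ≤ n) (f : Fin s → ℕ) (g : Fin n → ℕ) →
                  minSum (tabulate f) (tabulate g) ≡ ∑[ i < s ] (f i ⊓ g (inject≤ i s≤n))
minSum-tabulate z≤n       f g = refl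
minSum-tabulate (s≤s s≤n) f g = cong (f zero ⊓ g zero +_) (minSum-tabulate s≤n (f ∘ suc) (g ∘ suc))

minSum-[]ʳ : ∀ xs → minSum xs [] ≡ 0
minSum-[]ʳ []       = refl
minSum-[]ʳ (x ∷ xs) = refl

minSum-++-zeros : ∀ xs m ys → minSum (xs ++ replicate m 0) ys ≡ minSum xs ys
minSum-++-zeros []       zero    ys       = refl
minSum-++-zeros []       (suc m) []       = refl
minSum-++-zeros []       (suc m) (y ∷ ys) = minSum-++-zeros [] m ys
minSum-++-zeros (x ∷ xs) m       []       = refl
minSum-++-zeros (x ∷ xs) m       (y ∷ ys) = cong (x ⊓ y +_) (minSum-++-zeros xs m ys)

-- Two-element rearrangement. If `d ≤ x`, both minima with `d` equal `d`; if `x ≤ d`, both minima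
-- with `x` equal `x`. Monotonicity settles the remaining pair.
⊓-exchange-≤ : ∀ {x y c d} → x ≤ y → d ≤ c → x ⊓ c + y ⊓ d ≤ y ⊓ c + x ⊓ d
⊓-exchange-≤ {x} {y} {c} {d} x≤y d≤c with ℕ.≤-total x d
... | inj₂ d≤x = ℕ.+-mono-≤ (ℕ.⊓-monoˡ-≤ c x≤y)
  (ℕ.≤-reflexive (≡.trans (ℕ.m≥n⇒m⊓n≡n (≤-trans d≤x x≤y)) (sym (ℕ.m≥n⇒m⊓n≡n d≤x))))
... | inj₁ x≤d = begin
  x ⊓ c + y ⊓ d  ≡⟨ cong (_+ y ⊓ d) (≡.trans (ℕ.m≤n⇒m⊓n≡m (≤-trans x≤d d≤c)) (sym (ℕ.m≤n⇒m⊓n≡m x≤d))) ⟩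
  x ⊓ d + y ⊓ d  ≡⟨ ℕ.+-comm (x ⊓ d) _ ⟩
  y ⊓ d + x ⊓ d  ≤⟨ ℕ.+-monoˡ-≤ (x ⊓ d) (ℕ.⊓-monoʳ-≤ y d≤c) ⟩
  y ⊓ c + x ⊓ d  ∎
  where open ≤-Reasoning

-- The entry `x` moves left past the entries of `us` one at a time; each move is an exchange that
-- pairs the larger `x` with the larger element of `cs`.
minSum-toFront : ∀ {x} us {vs cs} → All (_≤ x) us → AllPairs _≥_ cs →
                 minSum (us ++ x ∷ vs) cs ≤ minSum (x ∷ us ++ vs) cs
minSum-toFront []       _            _  = ≤-refl
minSum-toFront (u ∷ us) (u≤x ∷ us≤x) [] = z≤n
minSum-toFront {x} (u ∷ us) {vs} {c ∷ []} (u≤x ∷ us≤x) _ = begin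
  u ⊓ c + minSum (us ++ x ∷ vs) []  ≡⟨ cong (u ⊓ c +_) (minSum-[]ʳ (us ++ x ∷ vs)) ⟩
  u ⊓ c + 0                         ≤⟨ ℕ.+-monoˡ-≤ 0 (ℕ.⊓-monoˡ-≤ c u≤x) ⟩
  x ⊓ c + 0                         ∎
  where open ≤-Reasoning
minSum-toFront {x} (u ∷ us) {vs} {c ∷ d ∷ cs} (u≤x ∷ us≤x) ((d≤c ∷ _) ∷ cs↘) = begin
  u ⊓ c + minSum (us ++ x ∷ vs) (d ∷ cs)   ≤⟨ ℕ.+-monoʳ-≤ (u ⊓ c) (minSum-toFront us us≤x cs↘) ⟩
  u ⊓ c + (x ⊓ d + minSum (us ++ vs) cs)   ≡⟨ ℕ.+-assoc (u ⊓ c) _ _ ⟨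
  (u ⊓ c + x ⊓ d) + minSum (us ++ vs) cs   ≤⟨ ℕ.+-monoˡ-≤ _ (⊓-exchange-≤ u≤x d≤c) ⟩
  (x ⊓ c + u ⊓ d) + minSum (us ++ vs) cs   ≡⟨ ℕ.+-assoc (x ⊓ c) _ _ ⟩
  x ⊓ c + (u ⊓ d + minSum (us ++ vs) cs)   ∎
  where open ≤-Reasoning

-- Selection sort: the head of `as` is the maximum of `es`, so moving it to the front does not lower
-- the sum; then both heads are removed.
minSum-sorted : ∀ {es as cs} → es ↭ as → AllPairs _≥_ as → AllPairs _≥_ cs →
                minSum es cs ≤ minSum as cs
minSum-sorted {es} {as} {[]} _ _ _ = ℕ.≤-reflexive (≡.trans (minSum-[]ʳ es) (sym (minSum-[]ʳ as)))
minSum-sorted {es} {[]} es↭ [] _ with ↭-length es↭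
minSum-sorted {[]} {[]} es↭ [] _ | _ = z≤n
minSum-sorted {es} {a ∷ as} {c ∷ cs} es↭ (as≤a ∷ as↘) (cs≤c ∷ cs↘)
  with us , vs , refl ← ∈-∃++ (∈-resp-↭ (↭-sym es↭) (here refl)) = begin
  minSum (us ++ a ∷ vs) (c ∷ cs)   ≤⟨ minSum-toFront us us≤a (cs≤c ∷ cs↘) ⟩
  a ⊓ c + minSum (us ++ vs) cs     ≤⟨ ℕ.+-monoʳ-≤ (a ⊓ c) (minSum-sorted (drop-mid us [] es↭) as↘ cs↘) ⟩
  a ⊓ c + minSum as cs             ∎
  where
  open ≤-Reasoning
  us≤a : All (_≤ a) us
  us≤a = All.++⁻ˡ us (All-resp-↭ (↭-sym es↭) (≤-refl ∷ as≤a))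

-- Zero entries and permutations in sums of minima

nonzero? : ∀ x → Dec (x ≢ 0)
nonzero? x = ¬? (x ℕ.≟ 0)

-- Dropping `c` makes each entry of `es` meet the next, smaller element.
minSum-shiftʳ : ∀ es {c cs} → AllPairs _≥_ (c ∷ cs) → minSum es cs ≤ minSum es (c ∷ cs)
minSum-shiftʳ es       {cs = []}     _ = ≤-trans (ℕ.≤-reflexive (minSum-[]ʳ es)) z≤n
minSum-shiftʳ []       {cs = d ∷ cs} _ = z≤n
minSum-shiftʳ (e ∷ es) {cs = d ∷ cs} ((d≤c ∷ _) ∷ cs↘) = ℕ.+-mono-≤ (ℕ.⊓-monoʳ-≤ e d≤c) (minSum-shiftʳ es cs↘)

-- A zero contributes nothing, and deleting it moves the later entries to earlier, larger partners.
-- The zeros are the classes that an edge misses.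
minSum-filter : ∀ es {cs} → AllPairs _≥_ cs → minSum es cs ≤ minSum (filter nonzero? es) cs
minSum-filter es {[]} _ = ≤-trans (ℕ.≤-reflexive (minSum-[]ʳ es)) z≤n
minSum-filter []             {c ∷ cs} _ = z≤n
minSum-filter (zero ∷ es)    {c ∷ cs} cs↘@(_ ∷ cs↘′) =
  ≤-trans (minSum-filter es cs↘′) (minSum-shiftʳ (filter nonzero? es) cs↘)
minSum-filter (e@(suc _) ∷ es) {c ∷ cs} (_ ∷ cs↘) = ℕ.+-monoʳ-≤ (e ⊓ c) (minSum-filter es cs↘)

-- The permutation of `cs` is carried over to `es`, so that every pair stays together. Equal lengths
-- ensure that each element of `cs` has a partner to carry along.
minSum-permute : ∀ {cs ds} → cs ↭ ds → ∀ es → length es ≡ length cs →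
                 ∃ λ es′ → es′ ↭ es × minSum es′ ds ≡ minSum es cs
minSum-permute refl es _ = es , refl , refl
minSum-permute (prep c p) (e ∷ es) len =
  let es′ , q , eq = minSum-permute p es (ℕ.suc-injective len)
  in e ∷ es′ , prep e q , cong (e ⊓ c +_) eq
minSum-permute {_ ∷ _ ∷ cs} {_ ∷ _ ∷ ds} (swap c d p) (e ∷ f ∷ es) len =
  let es′ , q , eq = minSum-permute p es (ℕ.suc-injective (ℕ.suc-injective len))
  in f ∷ e ∷ es′ , swap f e q , (begin
    f ⊓ d + (e ⊓ c + minSum es′ ds)   ≡⟨ ℕ.+-assoc (f ⊓ d) _ _ ⟨
    f ⊓ d + e ⊓ c + minSum es′ ds     ≡⟨ cong₂ _+_ (ℕ.+-comm (f ⊓ d) _) eq ⟩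
    e ⊓ c + f ⊓ d + minSum es cs      ≡⟨ ℕ.+-assoc (e ⊓ c) _ _ ⟩
    e ⊓ c + (f ⊓ d + minSum es cs)    ∎)
  where open ≡-Reasoning
minSum-permute (trans p₁ p₂) es len =
  let es₁ , q₁ , eq₁ = minSum-permute p₁ es len
      es₂ , q₂ , eq₂ = minSum-permute p₂ es₁ (≡.trans (↭-length q₁) (≡.trans len (↭-length p₁)))
  in es₂ , ↭-trans q₂ q₁ , ≡.trans eq₂ eq₁

-- The order is reversed so that sorting produces decreasing lists.
≥-decTotalOrder : DecTotalOrder _ _ _
≥-decTotalOrder = Flip.decTotalOrder ℕ.≤-decTotalOrder

open Data.List.Sort ≥-decTotalOrder using (sort; sort-↭; sort-↗)

sorted-tabulation : ∀ n xs → length xs ≡ n → ∃ λ (c : Fin n → ℕ) → Antitone c × tabulate c ↭ xs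
sorted-tabulation n xs len with refl ← ≡.trans (↭-length (sort-↭ xs)) len =
  lookup (sort xs) ,
  lookup-mono-≤ (DecTotalOrder.totalOrder ≥-decTotalOrder) (sort-↗ xs) ,
  subst (_↭ xs) (sym (List.tabulate-lookup (sort xs))) (sort-↭ xs)

Antitone⇒AllPairs : ∀ {n} {f : Fin n → ℕ} → Antitone f → AllPairs _≥_ (tabulate f)
Antitone⇒AllPairs f↘ = AllPairs.tabulate⁺-< λ i<j → f↘ (ℕ.<⇒≤ i<j)

-- Subsets of Fin (n * q) as families of n subsets of Fin q

∣++∣ : ∀ {m n} (xs : Subset m) (ys : Subset n) → ∣ xs Vec.++ ys ∣ ≡ ∣ xs ∣ + ∣ ys ∣
∣++∣ []             ys = refl
∣++∣ (inside  ∷ xs) ys = cong suc (∣++∣ xs ys)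
∣++∣ (outside ∷ xs) ys = ∣++∣ xs ys

∣++∩++∣ : ∀ {m n} (xs xs′ : Subset m) (ys ys′ : Subset n) →
          ∣ (xs Vec.++ ys) ∩ (xs′ Vec.++ ys′) ∣ ≡ ∣ xs ∩ xs′ ∣ + ∣ ys ∩ ys′ ∣
∣++∩++∣ xs xs′ ys ys′ = ≡.trans (cong ∣_∣ (Vec.zipWith-++ _ xs ys xs′ ys′)) (∣++∣ (xs ∩ xs′) (ys ∩ ys′))

sizes : ∀ {n q} → Vec (Subset q) n → List ℕ
sizes Ks = tabulate λ i → ∣ Vec.lookup Ks i ∣

∣concat∣ : ∀ {n q} (Ks : Vec (Subset q) n) → ∣ concat Ks ∣ ≡ sum (sizes Ks)
∣concat∣ []       = refl
∣concat∣ (K ∷ Ks) = ≡.trans (∣++∣ K (concat Ks)) (cong (∣ K ∣ +_) (∣concat∣ Ks))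

∣concat∩concat∣≤minSum : ∀ {n q} (Ks Ls : Vec (Subset q) n) →
                         ∣ concat Ks ∩ concat Ls ∣ ≤ minSum (sizes Ks) (sizes Ls)
∣concat∩concat∣≤minSum []       []       = z≤n
∣concat∩concat∣≤minSum (K ∷ Ks) (L ∷ Ls) = ≤-trans (ℕ.≤-reflexive (∣++∩++∣ K L (concat Ks) (concat Ls)))
  (ℕ.+-mono-≤ (∣p∩q∣≤∣p∣⊓∣q∣ K L) (∣concat∩concat∣≤minSum Ks Ls))

-- Vertex classes as consecutive blocks

tabulate-++ : ∀ {A : Set} m {n} (f : Fin (m + n) → A) →
              Vec.tabulate f ≡ Vec.tabulate (f ∘ (_↑ˡ n)) Vec.++ Vec.tabulate (f ∘ (m ↑ʳ_))
tabulate-++ zero    f = refl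
tabulate-++ (suc m) f = cong (f zero ∷_) (tabulate-++ m (f ∘ suc))

tabulate-const : ∀ {A : Set} {x : A} n {f : Fin n → A} → (∀ i → f i ≡ x) → Vec.tabulate f ≡ Vec.replicate n x
tabulate-const zero    f≡x = refl
tabulate-const (suc n) f≡x = cong₂ _∷_ (f≡x zero) (tabulate-const n (f≡x ∘ suc))

quotient-↑ˡ : ∀ n q (j : Fin q) → quotient {suc n} q (j ↑ˡ (n * q)) ≡ zero
quotient-↑ˡ n q j rewrite Fin.splitAt-↑ˡ q j (n * q) = refl

quotient-↑ʳ : ∀ n q (j : Fin (n * q)) → quotient {suc n} q (q ↑ʳ j) ≡ suc (quotient q j)
quotient-↑ʳ n q j rewrite Fin.splitAt-↑ʳ q (n * q) j = refl

vertexClass-zero : ∀ n q → vertexClass (suc n) q zero ≡ ⊤ {q} Vec.++ ⊥ {n * q}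
vertexClass-zero n q = ≡.trans (tabulate-++ q _) (cong₂ Vec._++_
  (tabulate-const q λ j → cong (λ x → does (x Fin.≟ zero)) (quotient-↑ˡ n q j))
  (tabulate-const (n * q) λ j → cong (λ x → does (x Fin.≟ zero)) (quotient-↑ʳ n q j)))

vertexClass-suc : ∀ n q i → vertexClass (suc n) q (suc i) ≡ ⊥ {q} Vec.++ vertexClass n q i
vertexClass-suc n q i = ≡.trans (tabulate-++ q _) (cong₂ Vec._++_
  (tabulate-const q λ j → cong (λ x → does (x Fin.≟ suc i)) (quotient-↑ˡ n q j))
  (Vec.tabulate-cong λ j → cong (λ x → does (x Fin.≟ suc i)) (quotient-↑ʳ n q j)))

∣p∩⊥∣≡0 : ∀ {n} (p : Subset n) → ∣ p ∩ ⊥ ∣ ≡ 0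
∣p∩⊥∣≡0 {n} p = ≡.trans (cong ∣_∣ (∩-zeroʳ p)) (∣⊥∣≡0 n)

-- The link between `sizes` and the hypergraph: the blocks of a `concat` are its intersections with
-- the vertex classes.
∣concat∩vertexClass∣ : ∀ n q (Ks : Vec (Subset q) n) i →
                       ∣ concat Ks ∩ vertexClass n q i ∣ ≡ ∣ Vec.lookup Ks i ∣
∣concat∩vertexClass∣ (suc n) q (K ∷ Ks) zero = begin
  ∣ concat (K ∷ Ks) ∩ vertexClass (suc n) q zero ∣  ≡⟨ cong (λ V → ∣ (K Vec.++ concat Ks) ∩ V ∣) (vertexClass-zero n q) ⟩
  ∣ concat (K ∷ Ks) ∩ (⊤ {q} Vec.++ ⊥) ∣            ≡⟨ ∣++∩++∣ K ⊤ (concat Ks) ⊥ ⟩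
  ∣ K ∩ ⊤ ∣ + ∣ concat Ks ∩ ⊥ ∣                     ≡⟨ cong₂ _+_ (cong ∣_∣ (∩-identityʳ K)) (∣p∩⊥∣≡0 (concat Ks)) ⟩
  ∣ K ∣ + 0                                         ≡⟨ ℕ.+-identityʳ ∣ K ∣ ⟩
  ∣ K ∣                                             ∎
  where open ≡-Reasoning
∣concat∩vertexClass∣ (suc n) q (K ∷ Ks) (suc i) = begin
  ∣ concat (K ∷ Ks) ∩ vertexClass (suc n) q (suc i) ∣  ≡⟨ cong (λ V → ∣ concat (K ∷ Ks) ∩ V ∣) (vertexClass-suc n q i) ⟩
  ∣ concat (K ∷ Ks) ∩ (⊥ Vec.++ vertexClass n q i) ∣   ≡⟨ ∣++∩++∣ K ⊥ (concat Ks) (vertexClass n q i) ⟩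
  ∣ K ∩ ⊥ ∣ + ∣ concat Ks ∩ vertexClass n q i ∣        ≡⟨ cong₂ _+_ (∣p∩⊥∣≡0 K) (∣concat∩vertexClass∣ n q Ks i) ⟩
  ∣ Vec.lookup Ks i ∣                                  ∎
  where open ≡-Reasoning

nonzeroIntersections-concat : ∀ {n q} (Ks : Vec (Subset q) n) →
                              nonzeroIntersections n q (concat Ks) ≡ filter nonzero? (sizes Ks)
nonzeroIntersections-concat {n} {q} Ks =
  cong (filter nonzero?) (List.tabulate-cong (∣concat∩vertexClass∣ n q Ks))

-- Sets of prescribed sizes with large intersections

-- Greedy choice: elements of `S` are always taken, and an element outside `S` only when the
-- remaining positions cannot hold the required number.
subsetMeeting : ∀ {q} (S : Subset q) e → e ≤ q → ∃ λ K → ∣ K ∣ ≡ e × e ⊓ ∣ S ∣ ≤ ∣ K ∩ S ∣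
subsetMeeting {q} S zero _ = ⊥ , ∣⊥∣≡0 q , z≤n
subsetMeeting (inside ∷ S) (suc e) (s≤s e≤q) =
  let K , ∣K∣≡e , meets = subsetMeeting S e e≤q in inside ∷ K , cong suc ∣K∣≡e , s≤s meets
subsetMeeting {suc q} (outside ∷ S) (suc e) (s≤s e≤q) with suc e ℕ.≤? q
... | yes e<q = let K , ∣K∣≡e , meets = subsetMeeting S (suc e) e<q in outside ∷ K , ∣K∣≡e , meets
-- Now `e` equals the number of remaining positions, so all of them are taken and the whole of `S`
-- is met.
... | no  e≮q =
  let K , ∣K∣≡e , meets = subsetMeeting S e e≤q
      ∣S∣≤e = ≤-trans (∣p∣≤n S) (s≤s⁻¹ (ℕ.≰⇒> e≮q))
  in inside ∷ K , cong suc ∣K∣≡e ,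
     ≤-trans (≤-trans (ℕ.m⊓n≤n (suc e) ∣ S ∣) (ℕ.≤-reflexive (sym (ℕ.m≥n⇒m⊓n≡n ∣S∣≤e)))) meets

familyMeeting : ∀ {n q} (Ss : Vec (Subset q) n) es → length es ≡ n → All (_≤ q) es →
                ∃ λ (Ks : Vec (Subset q) n) → sizes Ks ≡ es × minSum es (sizes Ss) ≤ ∣ concat Ks ∩ concat Ss ∣
familyMeeting []       []       _   []           = [] , refl , z≤n
familyMeeting (S ∷ Ss) (e ∷ es) len (e≤q ∷ es≤q) =
  let K  , ∣K∣≡e , meets  = subsetMeeting S e e≤q
      Ks , Ks≡es , meets′ = familyMeeting Ss es (ℕ.suc-injective len) es≤q
  in K ∷ Ks , cong₂ _∷_ ∣K∣≡e Ks≡es ,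
     subst (_ ≤_) (sym (∣++∩++∣ K S (concat Ks) (concat Ss))) (ℕ.+-mono-≤ meets meets′)

familyOfSizes : ∀ {n q} (c : Fin n → ℕ) → (∀ i → c i ≤ q) → ∃ λ (Ks : Vec (Subset q) n) → sizes Ks ≡ tabulate c
familyOfSizes {n} {q} c c≤q =
  -- Only the sizes matter here, so the sets to be met are taken empty.
  let Ks , Ks≡c , _ = familyMeeting (Vec.replicate n (⊥ {q})) (tabulate c) (List.length-tabulate c) (All.tabulate⁺ c≤q)
  in Ks , Ks≡c

-- Independent sets and their class sizes

module _ {n r q k : ℕ} (σ : Partition r) (s≤n : Partition.s σ ≤ n) where
  open Partition σ

  -- An edge spreads the parts of σ over the classes in some order, interspersed with zeros.
  -- Removing the zeros and sorting the parts can only increase the sum of minima that bounds its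
  -- intersection with the set.
  independentSize-∑ : (c : Fin n → ℕ) → Antitone c → (∀ i → c i ≤ q) →
                      ∑[ i < s ] (a i ⊓ c (inject≤ i s≤n)) ≤ k →
                      IndependentSize (σ-hypergraph n r q σ) k (∑[ i < n ] c i)
  independentSize-∑ c c↘ c≤q weight≤k =
    let Ss , Ss≡c = familyOfSizes c c≤q
    in concat Ss , independent Ss Ss≡c ,
       ≡.trans (∣concat∣ Ss) (≡.trans (cong sum Ss≡c) (sum-tabulate c))
    where
    independent : ∀ Ss → sizes Ss ≡ tabulate c → Independent (σ-hypergraph n r q σ) k (concat Ss)
    -- `Vec.group` splits `E` into its blocks, so that it becomes a `concat`.
    independent Ss Ss≡c E (_ , E↭a) with Es , refl ← Vec.group n q E = begin
      ∣ concat Es ∩ concat Ss ∣                         ≤⟨ ∣concat∩concat∣≤minSum Es Ss ⟩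
      minSum (sizes Es) (sizes Ss)                      ≡⟨ cong (minSum (sizes Es)) Ss≡c ⟩
      minSum (sizes Es) (tabulate c)                    ≤⟨ minSum-filter (sizes Es) (Antitone⇒AllPairs c↘) ⟩
      minSum (filter nonzero? (sizes Es)) (tabulate c)  ≤⟨ minSum-sorted (subst (_↭ tabulate a) (nonzeroIntersections-concat Es) E↭a)
                                                             (Antitone⇒AllPairs decreasing) (Antitone⇒AllPairs c↘) ⟩
      minSum (tabulate a) (tabulate c)                  ≡⟨ minSum-tabulate s≤n a c ⟩
      ∑[ i < s ] (a i ⊓ c (inject≤ i s≤n))              ≤⟨ weight≤k ⟩
      k                                                 ∎
      where open ≤-Reasoning

  -- The position of a class size in `c` decides which part goes into that class, and each class
  -- meets its part in as many points as possible. Every part fits into a class because the largest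
  -- one is at most `q`.
  edgeMeeting : a zero ≤ q → (Ss : Vec (Subset q) n) (c : Fin n → ℕ) → tabulate c ↭ sizes Ss →
                ∃ λ E → Hypergraph.Edge (σ-hypergraph n r q σ) E ×
                        ∑[ i < s ] (a i ⊓ c (inject≤ i s≤n)) ≤ ∣ E ∩ concat Ss ∣
  edgeMeeting a₀≤q Ss c c↭Ss = concat Es , (∣E∣≡r , E↭a) , (begin
      ∑[ i < s ] (a i ⊓ c (inject≤ i s≤n))   ≡⟨ minSum-tabulate s≤n a c ⟨
      minSum (tabulate a) (tabulate c)       ≡⟨ minSum-++-zeros (tabulate a) (n ∸ s) (tabulate c) ⟨
      minSum padded (tabulate c)             ≡⟨ proj₂ (proj₂ permuted) ⟨
      minSum es (sizes Ss)                   ≤⟨ proj₂ (proj₂ family) ⟩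
      ∣ concat Es ∩ concat Ss ∣              ∎)
    where
    padded : List ℕ
    -- The `n ∸ s` zeros stand for the classes that the edge misses, so there is one entry per
    -- class.
    padded = tabulate a ++ replicate (n ∸ s) 0

    padded-length : length padded ≡ n
    padded-length = ≡.trans (List.length-++ (tabulate a)) (≡.trans
      (cong₂ _+_ (List.length-tabulate a) (List.length-replicate (n ∸ s))) (ℕ.m+[n∸m]≡n s≤n))

    padded-≤ : All (_≤ q) padded
    padded-≤ = All.++⁺ (All.tabulate⁺ λ i → ≤-trans (decreasing {j = i} z≤n) a₀≤q) (All.replicate⁺ (n ∸ s) z≤n)

    padded-sum : sum padded ≡ r
    padded-sum = begin
      sum padded                                  ≡⟨ sum-++ (tabulate a) _ ⟩
      sum (tabulate a) + sum (replicate (n ∸ s) 0) ≡⟨ cong₂ _+_ (sum-tabulate a) (sum-zeros (n ∸ s)) ⟩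
      ∑[ i < s ] a i + 0                          ≡⟨ ℕ.+-identityʳ _ ⟩
      ∑[ i < s ] a i                              ≡⟨ total ⟩
      r                                           ∎
      where
      open ≡-Reasoning
      sum-zeros : ∀ m → sum (replicate m 0) ≡ 0
      sum-zeros zero    = refl
      sum-zeros (suc m) = sum-zeros m

    padded-filter : filter nonzero? padded ≡ tabulate a
    padded-filter = begin
      filter nonzero? padded
        ≡⟨ List.filter-++ nonzero? (tabulate a) _ ⟩
      filter nonzero? (tabulate a) ++ filter nonzero? (replicate (n ∸ s) 0)
        ≡⟨ cong₂ _++_ (List.filter-all nonzero? (All.tabulate⁺ λ i → ℕ.m<n⇒n≢0 (positive i)))
                      (List.filter-none nonzero? (All.replicate⁺ (n ∸ s) λ 0≢0 → 0≢0 refl)) ⟩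
      tabulate a ++ []
        ≡⟨ List.++-identityʳ _ ⟩
      tabulate a ∎
      where open ≡-Reasoning

    permuted = minSum-permute c↭Ss padded (≡.trans padded-length (sym (List.length-tabulate c)))
    es = proj₁ permuted

    es↭padded : es ↭ padded
    es↭padded = proj₁ (proj₂ permuted)

    family = familyMeeting Ss es (≡.trans (↭-length es↭padded) padded-length) (All-resp-↭ (↭-sym es↭padded) padded-≤)
    Es = proj₁ family

    Es≡es : sizes Es ≡ es
    Es≡es = proj₁ (proj₂ family)

    ∣E∣≡r : ∣ concat Es ∣ ≡ r
    ∣E∣≡r = ≡.trans (∣concat∣ Es) (≡.trans (cong sum Es≡es) (≡.trans (sum-↭ es↭padded) padded-sum))

    E↭a : nonzeroIntersections n q (concat Es) ↭ tabulate a
    E↭a = ≡.subst₂ _↭_ (sym (≡.trans (nonzeroIntersections-concat Es) (cong (filter nonzero?) Es≡es)))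
            padded-filter (filter-↭ nonzero? es↭padded)

    open ≤-Reasoning

  -- Independence is tested on the one edge that `edgeMeeting` builds for the sorted class sizes.
  sortedClassSizes : a zero ≤ q → ∀ {S} → Independent (σ-hypergraph n r q σ) k S →
                     ∃ λ (c : Fin n → ℕ) → Antitone c × (∀ i → c i ≤ q) ×
                       ∑[ i < n ] c i ≡ ∣ S ∣ × ∑[ i < s ] (a i ⊓ c (inject≤ i s≤n)) ≤ k
  sortedClassSizes a₀≤q {S} independent with Ss , refl ← Vec.group n q S =
    let c , c↘ , c↭Ss = sorted-tabulation n (sizes Ss) (List.length-tabulate λ i → ∣ Vec.lookup Ss i ∣)
        E , edge , meets = edgeMeeting a₀≤q Ss c c↭Ss
    in c , c↘ ,
       All.tabulate⁻ {P = _≤ q} (All-resp-↭ (↭-sym c↭Ss) (All.tabulate⁺ λ i → ∣p∣≤n (Vec.lookup Ss i))) ,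
       ≡.trans (sym (sum-tabulate c)) (≡.trans (sum-↭ c↭Ss) (sym (∣concat∣ Ss))) ,
       ≤-trans meets (independent E edge)

-- Feasible sequences

if-elim : ∀ {P : Set} (P? : Dec P) {x y : ℕ} (R : ℕ → Set) →
          (P → R x) → (¬ P → R y) → R (if does P? then x else y)
if-elim (yes p) R Rx Ry = Rx p
if-elim (no ¬p) R Rx Ry = Ry ¬p

antitone-∷ : ∀ {n x} {f : Fin n → ℕ} → (∀ i → f i ≤ x) → Antitone f → Antitone (x Functional.∷ f)
antitone-∷ f≤x f↘ {zero}  {zero}  _         = ≤-refl
antitone-∷ f≤x f↘ {zero}  {suc j} _         = f≤x j
antitone-∷ f≤x f↘ {suc i} {suc j} (s≤s i≤j) = f↘ i≤j

-- If `a ≤ g`, the minimum is already `a`, which forces `m` to be `a`, and `g` stays. Otherwise `m`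
-- itself lies between `g` and `a`.
⊓-raise : ∀ {a g m} → a ⊓ g ≤ m → m ≤ a → ∃ λ x → g ≤ x × x ≤ g ⊔ a × a ⊓ x ≡ m
⊓-raise {a} {g} {m} ≤m m≤a with ℕ.≤-total a g
... | inj₁ a≤g = g , ≤-refl , ℕ.m≤m⊔n g a , ℕ.≤-antisym ≤m (≤-trans m≤a (ℕ.⊓-glb ≤-refl a≤g))
... | inj₂ g≤a = m , subst (_≤ m) (ℕ.m≥n⇒m⊓n≡n g≤a) ≤m , ≤-trans m≤a (ℕ.m≤n⊔m g a) , ℕ.m≥n⇒m⊓n≡n m≤a

-- Entries are raised from left to right up to a i, the last one only partially;
-- the bound by g i ⊔ a i keeps the result antitone.
raiseWeight : ∀ {s} (a g : Fin s → ℕ) → Antitone a → Antitone g → ∀ k →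
              ∑[ i < s ] (a i ⊓ g i) ≤ k → k ≤ ∑[ i < s ] a i →
              ∃ λ (h : Fin s → ℕ) → Antitone h × (∀ i → g i ≤ h i) × (∀ i → h i ≤ g i ⊔ a i) ×
                ∑[ i < s ] (a i ⊓ h i) ≡ k
raiseWeight {zero} a g a↘ g↘ k _ k≤0 = g , g↘ , (λ ()) , (λ ()) , sym (ℕ.n≤0⇒n≡0 k≤0)
raiseWeight {suc s} a g a↘ g↘ k w≤k k≤a with ℕ.≤-total k (∑[ i < s ] (a (suc i) ⊓ g (suc i)) + a zero)
-- The head alone can supply the missing weight: its share becomes `k` minus the weight of the
-- unchanged tail, which is at most `a zero`.
... | inj₁ k≤ =
  let w = ∑[ i < s ] (a (suc i) ⊓ g (suc i))
      x , g₀≤x , x≤ , eq = ⊓-raise (ℕ.m+n≤o⇒m≤o∸n (a zero ⊓ g zero) w≤k) (ℕ.m≤n+o⇒m∸n≤o k w k≤)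
  in x Functional.∷ (g ∘ suc) ,
     antitone-∷ (λ i → ≤-trans (g↘ z≤n) g₀≤x) (λ i≤j → g↘ (s≤s i≤j)) ,
     (λ { zero → g₀≤x ; (suc i) → ≤-refl }) ,
     (λ { zero → x≤ ; (suc i) → ℕ.m≤m⊔n _ _ }) ,
     ≡.trans (cong (_+ w) eq) (ℕ.m∸n+n≡m (ℕ.m+n≤o⇒n≤o (a zero ⊓ g zero) w≤k))
-- Even a full head does not push the weight beyond `k`, so the head contributes all of `a zero` and
-- the tail is raised to the rest.
... | inj₂ ≤k =
  let w = ∑[ i < s ] (a (suc i) ⊓ g (suc i))
      h , h↘ , g≤h , h≤ , eq = raiseWeight (a ∘ suc) (g ∘ suc) (λ i≤j → a↘ (s≤s i≤j)) (λ i≤j → g↘ (s≤s i≤j))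
        (k ∸ a zero) (ℕ.m+n≤o⇒m≤o∸n w ≤k) (ℕ.m≤n+o⇒m∸n≤o k (a zero) k≤a)
  in (g zero ⊔ a zero) Functional.∷ h ,
     antitone-∷ (λ i → ≤-trans (h≤ i) (ℕ.⊔-mono-≤ (g↘ z≤n) (a↘ z≤n))) h↘ ,
     (λ { zero → ℕ.m≤m⊔n _ _ ; (suc i) → g≤h i }) ,
     (λ { zero → ≤-refl ; (suc i) → h≤ i }) ,
     ≡.trans (cong₂ _+_ (ℕ.m≤n⇒m⊓n≡m (ℕ.m≤n⊔m (g zero) (a zero))) eq)
             (ℕ.m+[n∸m]≡n (ℕ.m+n≤o⇒n≤o w ≤k))

module _ {n r q k : ℕ} (σ : Partition r) (s≤n : Partition.s σ ≤ n) where
  open Partition σ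

  -- Composition with `clamp` extends a sequence of length `s` to length `n` by repeating its last
  -- entry, as feasibility demands.
  clamp : Fin n → Fin s
  clamp j = fromℕ< (s≤s (ℕ.m⊓n≤n (toℕ j) s-1))

  toℕ-clamp : ∀ j → toℕ (clamp j) ≡ toℕ j ⊓ s-1
  toℕ-clamp j = Fin.toℕ-fromℕ< (s≤s (ℕ.m⊓n≤n (toℕ j) s-1))

  clamp-mono : ∀ {i j} → i Fin.≤ j → clamp i Fin.≤ clamp j
  clamp-mono {i} {j} i≤j = ≡.subst₂ _≤_ (sym (toℕ-clamp i)) (sym (toℕ-clamp j)) (ℕ.⊓-monoˡ-≤ s-1 i≤j)

  clamp-≤ : ∀ j → inject≤ (clamp j) s≤n Fin.≤ j
  clamp-≤ j = subst (_≤ toℕ j) (sym (≡.trans (Fin.toℕ-inject≤ (clamp j) s≤n) (toℕ-clamp j))) (ℕ.m⊓n≤m (toℕ j) s-1)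

  clamp-inject≤ : ∀ i → clamp (inject≤ i s≤n) ≡ i
  clamp-inject≤ i = Fin.toℕ-injective (≡.trans (toℕ-clamp _) (≡.trans (cong (_⊓ s-1) (Fin.toℕ-inject≤ i s≤n))
    (ℕ.m≤n⇒m⊓n≡m (s≤s⁻¹ (Fin.toℕ<n i)))))

  clamp-last : ∀ j → s ≤ suc (toℕ j) → clamp j ≡ fromℕ s-1
  clamp-last j s≤j = Fin.toℕ-injective (≡.trans (toℕ-clamp j)
    (≡.trans (ℕ.m≥n⇒m⊓n≡n (s≤s⁻¹ s≤j)) (sym (Fin.toℕ-fromℕ s-1))))

  -- The first `s` entries are raised to weight exactly `k`, possible since `k` is below the sum `r`
  -- of the parts, and the last of them is repeated. As `c` decreases, its tail stays below the
  -- repeated entry.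
  feasibleAbove : a zero ≤ q → k < r → (c : Fin n → ℕ) → Antitone c → (∀ i → c i ≤ q) →
                  ∑[ i < s ] (a i ⊓ c (inject≤ i s≤n)) ≤ k →
                  ∃ λ b → Feasible q k σ s≤n b × (∀ i → c i ≤ b i)
  feasibleAbove a₀≤q k<r c c↘ c≤q weight≤k =
    let h , h↘ , c≤h , h≤ , eq = raiseWeight a (λ i → c (inject≤ i s≤n)) decreasing
          (λ {i} {j} i≤j → c↘ (≡.subst₂ _≤_ (sym (Fin.toℕ-inject≤ i s≤n)) (sym (Fin.toℕ-inject≤ j s≤n)) i≤j))
          k weight≤k (subst (k ≤_) (sym total) (ℕ.<⇒≤ k<r))
    in h ∘ clamp , record
      { decreasing = λ i≤j → h↘ (clamp-mono i≤j)
      ; constant   = λ j s≤j → cong h (≡.trans (clamp-last j s≤j) (sym (clamp-inject≤ (fromℕ s-1))))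
      -- Raised entries are at most the maximum of an entry of `c` and a part of σ, hence at most
      -- `q`.
      ; bounded    = ℕ.⊔-lub a₀≤q (≤-trans (h≤ _) (ℕ.⊔-lub (c≤q _) (≤-trans (decreasing z≤n) a₀≤q)))
      ; weight     = ≡.trans (sum-cong-≋ λ i → cong (λ j → a i ⊓ h j) (clamp-inject≤ i)) eq
      } , λ j → ≤-trans (c↘ (clamp-≤ j)) (c≤h (clamp j))

  module _ {b : Fin n → ℕ} (f : Feasible q k σ s≤n b) where
    open Feasible f using (constant; bounded; weight) renaming (decreasing to b↘)

    feasible-≤ : ∀ j → b j ≤ q
    feasible-≤ j = ≤-trans (b↘ (subst (_≤ toℕ j) (sym (Fin.toℕ-inject≤ (zero {s-1}) s≤n)) z≤n)) (ℕ.m⊔n≤o⇒n≤o (a zero) _ bounded)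

    -- This rules out domination: a dominating sequence would give too large an independent set.
    feasible⇒independentSize : IndependentSize (σ-hypergraph n r q σ) k (∑[ i < n ] b i)
    feasible⇒independentSize = independentSize-∑ σ s≤n b b↘ feasible-≤ (ℕ.≤-reflexive weight)

    -- Filling the classes before the first deficit

    module _ {t₀ : Fin s} (deficit : IsFirstDeficit q k σ s≤n b t₀) where

      filled : Fin n → ℕ
      filled j = if does (toℕ t₀ ℕ.≤? toℕ j) then b j else q

      filled-≥ : ∀ j → b j ≤ filled j
      filled-≥ j = if-elim (toℕ t₀ ℕ.≤? toℕ j) (b j ≤_) (λ _ → ≤-refl) (λ _ → feasible-≤ j)

      filled-≤ : ∀ j → filled j ≤ q
      filled-≤ j = if-elim (toℕ t₀ ℕ.≤? toℕ j) (_≤ q) (λ _ → feasible-≤ j) (λ _ → ≤-refl)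

      filled-antitone : Antitone filled
      filled-antitone {i} {j} i≤j = if-elim (toℕ t₀ ℕ.≤? toℕ i) (filled j ≤_)
        (λ t≤i → if-elim (toℕ t₀ ℕ.≤? toℕ j) (_≤ b i) (λ _ → b↘ i≤j) (λ t≰j → contradiction (≤-trans t≤i i≤j) t≰j))
        (λ _ → filled-≤ j)

      filled-inject≤ : ∀ i → filled (inject≤ i s≤n) ≡ (if does (t₀ Fin.≤? i) then b (inject≤ i s≤n) else q)
      filled-inject≤ i = cong (λ m → if does (toℕ t₀ ℕ.≤? m) then b (inject≤ i s≤n) else q) (Fin.toℕ-inject≤ i s≤n)

      -- Before the first deficit both `q` and the entry of `b` are at least `a i`, so either
      -- minimum is `a i`.
      filled-weight : ∀ i → a i ⊓ filled (inject≤ i s≤n) ≡ a i ⊓ b (inject≤ i s≤n)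
      filled-weight i = ≡.trans (cong (a i ⊓_) (filled-inject≤ i))
        (if-elim (t₀ Fin.≤? i) (λ x → a i ⊓ x ≡ a i ⊓ b (inject≤ i s≤n)) (λ _ → refl) λ t≰i → ≡.trans
          (ℕ.m≤n⇒m⊓n≡m (≤-trans (decreasing z≤n) (ℕ.m⊔n≤o⇒m≤o (a zero) _ bounded)))
          (sym (ℕ.m≤n⇒m⊓n≡m (ℕ.≮⇒≥ λ b<a → t≰i (proj₂ deficit i b<a)))))

      filled-constant : ∀ j → s ≤ toℕ j → filled j ≡ b (inject≤ (fromℕ s-1) s≤n)
      filled-constant j s≤j = if-elim (toℕ t₀ ℕ.≤? toℕ j) (_≡ b (inject≤ (fromℕ s-1) s≤n))
        -- `constant` applies from index `s-1` on, one place before the tail considered here.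
        (λ _ → constant j (ℕ.m≤n⇒m≤1+n s≤j))
        (λ t≰j → contradiction (≤-trans (ℕ.<⇒≤ (Fin.toℕ<n t₀)) s≤j) t≰j)

      ∑-filled : ∑[ j < n ] filled j ≡
                 q * toℕ t₀ + ∑[ i < s ] (if does (t₀ Fin.≤? i) then b (inject≤ i s≤n) else 0)
                 + (n ∸ s) * b (inject≤ (fromℕ s-1) s≤n)
      ∑-filled = ≡.trans (∑-inject≤ s≤n filled _ filled-constant)
        (cong (_+ (n ∸ s) * b (inject≤ (fromℕ s-1) s≤n))
          (≡.trans (sum-cong-≋ filled-inject≤) (∑-fill q t₀ λ i → b (inject≤ i s≤n))))

      filled⇒independentSize : IndependentSize (σ-hypergraph n r q σ) k (∑[ j < n ] filled j)
      filled⇒independentSize = independentSize-∑ σ s≤n filled filled-antitone filled-≤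
        (ℕ.≤-reflexive (≡.trans (sum-cong-≋ filled-weight) weight))

    module _ (k<r : k < r) where
      private
        deficit : IsFirstDeficit q k σ s≤n b (t q k σ s≤n k<r f)
        deficit = proj₂ (firstDeficit q k σ s≤n k<r f)

      value⇒independentSize : IndependentSize (σ-hypergraph n r q σ) k (value q k σ s≤n k<r f)
      value⇒independentSize = subst (IndependentSize (σ-hypergraph n r q σ) k) (∑-filled deficit)
        (filled⇒independentSize deficit)

      ∑≤value : ∑[ i < n ] b i ≤ value q k σ s≤n k<r f
      ∑≤value = ≤-trans (∑-mono-≤ (filled-≥ deficit)) (ℕ.≤-reflexive (∑-filled deficit))

theorem2p8 : ∀ (n r q k : ℕ) → 1 ≤ r → (σ : Partition r) (s≤n : Partition.s σ ≤ n) → Partition.a σ zero ≤ q →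
    1 ≤ k → (k<r : k < r) →
    IsMaximum
    (λ x → ∃ λ (B : Fin n → ℕ) → Σ (M q k σ s≤n B) λ B∈M → x ≡ value q k σ s≤n k<r (M.feasible B∈M))
    (α (σ-hypergraph n r q σ) k)
theorem2p8 n r q k _ σ s≤n a₀≤q _ k<r with α-isMaximum (σ-hypergraph n r q σ) k
... | (S , independent , ∣S∣≡α) , ≤α =
  let c , c↘ , c≤q , ∑c≡∣S∣ , weight≤k = sortedClassSizes σ s≤n a₀≤q independent
      b , f , c≤b = feasibleAbove σ s≤n a₀≤q k<r c c↘ c≤q weight≤k
      α≤∑b = ≤-trans (ℕ.≤-reflexive (≡.trans (sym ∣S∣≡α) (sym ∑c≡∣S∣))) (∑-mono-≤ c≤b)
      b∈M = record
        -- The sum of `b` is already at least `α`, the largest size of an independent set, so no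
        -- feasible sequence has a larger sum.
        { feasible = f
        ; maximal  = λ (b* , f* , _ , ∑b<∑b*) →
            ℕ.<⇒≱ ∑b<∑b* (≤-trans (≤α _ (feasible⇒independentSize σ s≤n f*)) α≤∑b)
        }
  -- Equality is a squeeze: `α` is at most the sum of `b`, which is at most its value, which is the
  -- size of an independent set.
  in (b , b∈M , ℕ.≤-antisym (≤-trans α≤∑b (∑≤value σ s≤n f k<r)) (≤α _ (value⇒independentSize σ s≤n f k<r))) ,
     λ { _ (b′ , b′∈M , refl) → ≤α _ (value⇒independentSize σ s≤n (M.feasible b′∈M) k<r) }
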